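{- Let $G$ be a graph with $n$ vertices and minimum degree $\delta$, and let $k$ be a positive integer. (i) If $span(G) \geq R(k,k)$ and $\delta \geq k$, then $\gamma_{ir}(G) \leq n-k$. (ii) If $span(G) \geq 5$ and $\delta \geq 3$, then $\gamma_{ir}(G) \leq n-3$.
   Context: All graphs are finite, simple, undirected and have at least one vertex. $N(v)$ denotes the set of neighbours of a vertex $v$. A dominating set of $G$ is a set $D \subseteq V(G)$ such that every vertex in $V(G)\setminus D$ has a neighbour in $D$. An irregular dominating set of $G$ is a dominating set $D$ of $G$ such that $|N(u) \cap D| \neq |N(v) \cap D|$ for every two distinct vertices $u, v \in V(G) \setminus D$ (in particular, $V(G)$ is one). The irregular domination number $\gamma_{ir}(G)$ is the size of a smallest irregular dominating set of $G$. $span(G)$ is the number of distinct vertex degrees of $G$. The Ramsey number $R(p,q)$ is the smallest number $N$ such that every graph on $N$ vertices contains a clique of order $p$ or an independent set of order $q$. -}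

module Defs where

open import Data.Fin.Base using (Fin; zero; suc)
open import Data.Fin.Properties as Fin using (all?; any?)
open import Data.Fin.Subset using (Subset; ⊤; _∈_; _∉_; _∩_; ∣_∣)
open import Data.Fin.Subset.Properties using (_∈?_; anySubset?; ∈⊤)
open import Data.List.Base using (length; map; allFin; deduplicate)
open import Data.Nat.Base using (ℕ; zero; suc; _≤_; z≤n; s≤s; NonZero)
open import Data.Nat.Properties as ℕ using ()
open import Data.Product.Base using (∃; _×_; _,_; proj₁)
open import Data.Sum.Base using (_⊎_)
open import Data.Vec.Base using (tabulate)
open import Function.Base using (_∘_)
open import Level using (Level; 0ℓ)
open import Relation.Binary.Core using (Rel)
open import Relation.Binary.Definitions using (Symmetric; Irreflexive)
  renaming (Decidable to Decidable₂)
open import Relation.Binary.PropositionalEquality using (_≡_; _≢_; refl)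
open import Relation.Nullary using (¬_; yes; no; does; contradiction)
open import Relation.Nullary.Decidable using (_×-dec_; _→-dec_; ¬?)
open import Relation.Unary using (Pred; Decidable)

IsLeast : {ℓ : Level} → Pred ℕ ℓ → Pred ℕ ℓ
IsLeast P m = P m × (∀ j → P j → m ≤ j)

least : {ℓ : Level} {P : Pred ℕ ℓ} → Decidable P → (m : ℕ) → P m → ∃ (IsLeast P)
least P? zero p = zero , p , λ _ _ → z≤n
least P? (suc m) p with P? zero
... | yes p₀ = zero , p₀ , λ _ _ → z≤n
... | no ¬p₀ with least (P? ∘ suc) m p
...   | l , pl , l-min = suc l , pl , λ where
          zero    p₀ → contradiction p₀ ¬p₀
          (suc j) pj → s≤s (l-min j pj)

-- The vertex set is Fin n.  The graph on no vertices is allowed here;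
-- nonemptiness is imposed separately by NonZero n.
record Graph (n : ℕ) : Set₁ where
  field
    Adj        : Rel (Fin n) 0ℓ
    adj?       : Decidable₂ Adj
    adj-sym    : Symmetric Adj
    adj-irrefl : Irreflexive _≡_ Adj

module _ {n : ℕ} (G : Graph n) where
  open Graph G

  N : Fin n → Subset n
  N v = tabulate (λ u → does (adj? v u))

  degree : Fin n → ℕ
  degree v = ∣ N v ∣

  span : ℕ
  span = length (deduplicate ℕ._≟_ (map degree (allFin n)))

  IsClique : Subset n → Set
  IsClique S = ∀ u v → u ∈ S → v ∈ S → u ≢ v → Adj u v

  IsIndependent : Subset n → Set
  IsIndependent S = ∀ u v → u ∈ S → v ∈ S → ¬ Adj u v

  IsDominating : Subset n → Set
  IsDominating D = ∀ v → v ∉ D → ∃ λ u → u ∈ D × Adj v u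

  IsIrregularDominating : Subset n → Set
  IsIrregularDominating D =
    IsDominating D ×
    (∀ u v → u ∉ D → v ∉ D → u ≢ v → ∣ N u ∩ D ∣ ≢ ∣ N v ∩ D ∣)

  isIrregularDominating? : Decidable IsIrregularDominating
  isIrregularDominating? D =
    all? (λ v → ¬? (v ∈? D) →-dec any? (λ u → (u ∈? D) ×-dec adj? v u))
    ×-dec
    all? (λ u → all? (λ v →
      ¬? (u ∈? D) →-dec (¬? (v ∈? D) →-dec (¬? (u Fin.≟ v) →-dec
      ¬? (∣ N u ∩ D ∣ ℕ.≟ ∣ N v ∩ D ∣)))))

  HasIrregularDominatingSetOfSize : Pred ℕ 0ℓ
  HasIrregularDominatingSetOfSize d = ∃ λ D → IsIrregularDominating D × ∣ D ∣ ≡ d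

  γir-spec : ∃ (IsLeast HasIrregularDominatingSetOfSize)
  γir-spec = least
    (λ d → anySubset? (λ D → isIrregularDominating? D ×-dec (∣ D ∣ ℕ.≟ d)))
    ∣ ⊤ {n} ∣
    ( ⊤
    , ( (λ _ v∉⊤ → contradiction ∈⊤ v∉⊤)
      , (λ _ _ u∉⊤ → contradiction ∈⊤ u∉⊤))
    , refl)

  γir : ℕ
  γir = proj₁ γir-spec

HasVertexOfDegree : {n : ℕ} → Graph n → Pred ℕ 0ℓ
HasVertexOfDegree G d = ∃ λ v → degree G v ≡ d

minDegree-spec : {n : ℕ} .{{_ : NonZero n}} (G : Graph n) →
                 ∃ (IsLeast (HasVertexOfDegree G))
minDegree-spec {suc n} G =
  least (λ d → any? (λ v → degree G v ℕ.≟ d)) (degree G zero) (zero , refl)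

minDegree : {n : ℕ} .{{_ : NonZero n}} → Graph n → ℕ
minDegree G = proj₁ (minDegree-spec G)

-- For p, q ≥ 1 the graph on no vertices makes this fail at N = 0, so the
-- least such N is the least among positive N.
RamseyProperty : ℕ → ℕ → ℕ → Set₁
RamseyProperty p q N = (H : Graph N) →
  (∃ λ S → IsClique H S × ∣ S ∣ ≡ p) ⊎ (∃ λ S → IsIndependent H S × ∣ S ∣ ≡ q)

-- IsRamseyNumber p q r says that R(p,q) = r.
IsRamseyNumber : ℕ → ℕ → ℕ → Set₁
IsRamseyNumber p q = IsLeast (RamseyProperty p q)

{-# OPTIONS --safe #-}

-- If D is the complement of S, a vertex u of S has degree u − |N(u) ∩ S|
-- neighbours in D.  So D is irregular dominating as soon as |S| ≤ δ, the
-- degrees on S are distinct, and a larger degree never comes with a larger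
-- degree inside S.  The last condition holds when S is a clique, when S is
-- independent, and when S is a star whose centre has the least degree.
--
-- (i) Ramsey's theorem applied to r vertices of distinct degrees gives a clique
-- or an independent set of size k.
--
-- (ii) Among five vertices of distinct degrees let b have the least degree.  If
-- b has two neighbours among the other four, they form a clique or a star with
-- b.  Otherwise b has three non-neighbours: they form a clique, or two of them
-- are independent together with b.
module Submission where

open import Defs
open import Data.Fin.Base using (Fin; zero; suc; inject≤; punchIn)
open import Data.Fin.Patterns using (0F; 1F; 2F; 3F)
open import Data.Fin.Properties as Fin using (inject≤-injective; punchIn-injective; punchInᵢ≢i)
open import Data.Fin.Subset
open import Data.Fin.Subset.Properties
open import Data.List.Base using (List; lookup; map; allFin; deduplicate)
open import Data.List.Extrema.Nat using (argmin; f[argmin]≤f[xs])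
open import Data.List.Membership.Propositional.Properties
  using (∈-lookup; ∈-map⁻; ∈-deduplicate⁻; ∈-allFin)
open import Data.List.Relation.Unary.All as All using ()
open import Data.List.Relation.Unary.AllPairs using (_∷_)
open import Data.List.Relation.Unary.Unique.Propositional using (Unique)
open import Data.List.Relation.Unary.Unique.DecPropositional.Properties using (deduplicate-!)
open import Data.Nat using (ℕ; suc; _+_; _≤_; _<_; _≥_; _∸_; z≤n; s≤s⁻¹; NonZero)
open import Data.Nat.Properties
open import Data.Product using (∃; _×_; _,_; proj₁; proj₂)
open import Data.Sum using (_⊎_; inj₁; inj₂; [_,_]′)
open import Data.Vec.Base using ([]; _∷_; here; there)
open import Data.Vec.Properties using ([]=⇒lookup; lookup⇒[]=; lookup∘tabulate)
open import Function.Base using (_∘_)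
open import Function.Definitions using (Injective)
open import Level using (0ℓ)
open import Relation.Binary.Core using (Rel)
open import Relation.Binary.Definitions using (Symmetric; tri<; tri≈; tri>)
open import Relation.Binary.PropositionalEquality
open import Relation.Nullary using (¬_; yes; no; contradiction)
open import Relation.Nullary.Decidable using (dec-true)
open import Relation.Unary using (Pred; Decidable)

private variable
  m n : ℕ

-- Cardinalities of subsets.

∣p∩q∣+∣p∩∁q∣≡∣p∣ : (p q : Subset n) → ∣ p ∩ q ∣ + ∣ p ∩ ∁ q ∣ ≡ ∣ p ∣
∣p∩q∣+∣p∩∁q∣≡∣p∣ []            []            = refl
∣p∩q∣+∣p∩∁q∣≡∣p∣ (outside ∷ p) (_ ∷ q)       = ∣p∩q∣+∣p∩∁q∣≡∣p∣ p q
∣p∩q∣+∣p∩∁q∣≡∣p∣ (inside ∷ p)  (inside ∷ q)  = cong suc (∣p∩q∣+∣p∩∁q∣≡∣p∣ p q)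
∣p∩q∣+∣p∩∁q∣≡∣p∣ (inside ∷ p)  (outside ∷ q) =
  trans (+-suc ∣ p ∩ q ∣ ∣ p ∩ ∁ q ∣) (cong suc (∣p∩q∣+∣p∩∁q∣≡∣p∣ p q))

x∉p⇒∣⁅x⁆∪p∣≡1+∣p∣ : {x : Fin n} {p : Subset n} → x ∉ p → ∣ ⁅ x ⁆ ∪ p ∣ ≡ suc ∣ p ∣
x∉p⇒∣⁅x⁆∪p∣≡1+∣p∣ {x = zero}  {inside ∷ p}  x∉p = contradiction here x∉p
x∉p⇒∣⁅x⁆∪p∣≡1+∣p∣ {x = zero}  {outside ∷ p} x∉p = cong (suc ∘ ∣_∣) (∪-identityˡ p)
x∉p⇒∣⁅x⁆∪p∣≡1+∣p∣ {x = suc x} {inside ∷ p}  x∉p = cong suc (x∉p⇒∣⁅x⁆∪p∣≡1+∣p∣ (x∉p ∘ there))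
x∉p⇒∣⁅x⁆∪p∣≡1+∣p∣ {x = suc x} {outside ∷ p} x∉p = x∉p⇒∣⁅x⁆∪p∣≡1+∣p∣ (x∉p ∘ there)

0<∣p∣⇒Nonempty : {p : Subset n} → 0 < ∣ p ∣ → Nonempty p
0<∣p∣⇒Nonempty {n} {p} 0<∣p∣ with nonempty? p
... | yes p≢∅ = p≢∅
... | no  p≡∅ =
  contradiction (subst (0 <_) (trans (cong ∣_∣ (Empty-unique p≡∅)) (∣⊥∣≡0 n)) 0<∣p∣) λ ()

-- Images of subsets under maps.

image : (Fin m → Fin n) → Subset m → Subset n
image f []            = ⊥
image f (inside ∷ p)  = ⁅ f zero ⁆ ∪ image (f ∘ suc) p
image f (outside ∷ p) = image (f ∘ suc) p

∈-image⁻ : (f : Fin m → Fin n) (p : Subset m) {x : Fin n} →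
           x ∈ image f p → ∃ λ i → i ∈ p × x ≡ f i
∈-image⁻ f []            x∈ = contradiction x∈ ∉⊥
∈-image⁻ f (outside ∷ p) x∈ with ∈-image⁻ (f ∘ suc) p x∈
... | i , i∈p , x≡fi = suc i , there i∈p , x≡fi
∈-image⁻ f (inside ∷ p)  x∈ with x∈p∪q⁻ ⁅ f zero ⁆ (image (f ∘ suc) p) x∈
... | inj₁ x∈⁅f0⁆ = zero , here , x∈⁅y⁆⇒x≡y (f zero) x∈⁅f0⁆
... | inj₂ x∈im with ∈-image⁻ (f ∘ suc) p x∈im
...   | i , i∈p , x≡fi = suc i , there i∈p , x≡fi

-- Injectivity puts `f zero` outside the image of the remaining elements, so each union with a
-- singleton adds exactly one.
∣image∣ : (f : Fin m → Fin n) → Injective _≡_ _≡_ f → (p : Subset m) → ∣ image f p ∣ ≡ ∣ p ∣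
∣image∣ {n = n} f f-inj []      = ∣⊥∣≡0 n
∣image∣ f f-inj (outside ∷ p)   = ∣image∣ (f ∘ suc) (Fin.suc-injective ∘ f-inj) p
∣image∣ f f-inj (inside ∷ p)    =
  trans (x∉p⇒∣⁅x⁆∪p∣≡1+∣p∣ f0∉) (cong suc (∣image∣ (f ∘ suc) (Fin.suc-injective ∘ f-inj) p))
  where
  f0∉ : f zero ∉ image (f ∘ suc) p
  f0∉ f0∈ with ∈-image⁻ (f ∘ suc) p f0∈
  ... | i , _ , f0≡fi = Fin.0≢1+n (f-inj f0≡fi)

-- Three-element subsets.

triple : Fin n → Fin n → Fin n → Subset n
triple x y z = ⁅ x ⁆ ∪ (⁅ y ⁆ ∪ ⁅ z ⁆)

∈-triple⁻ : {x y z u : Fin n} → u ∈ triple x y z → u ≡ x ⊎ u ≡ y ⊎ u ≡ z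
∈-triple⁻ {x = x} {y} {z} u∈ with x∈p∪q⁻ ⁅ x ⁆ (⁅ y ⁆ ∪ ⁅ z ⁆) u∈
... | inj₁ u∈⁅x⁆ = inj₁ (x∈⁅y⁆⇒x≡y x u∈⁅x⁆)
... | inj₂ u∈′ with x∈p∪q⁻ ⁅ y ⁆ ⁅ z ⁆ u∈′
...   | inj₁ u∈⁅y⁆ = inj₂ (inj₁ (x∈⁅y⁆⇒x≡y y u∈⁅y⁆))
...   | inj₂ u∈⁅z⁆ = inj₂ (inj₂ (x∈⁅y⁆⇒x≡y z u∈⁅z⁆))

∈-tripleˡ : {x y z : Fin n} → x ∈ triple x y z
∈-tripleˡ {x = x} {y} {z} = p⊆p∪q (⁅ y ⁆ ∪ ⁅ z ⁆) (x∈⁅x⁆ x)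

∣triple∣ : {x y z : Fin n} → x ≢ y → x ≢ z → y ≢ z → ∣ triple x y z ∣ ≡ 3
∣triple∣ {x = x} {y} {z} x≢y x≢z y≢z = begin
  ∣ ⁅ x ⁆ ∪ (⁅ y ⁆ ∪ ⁅ z ⁆) ∣  ≡⟨ x∉p⇒∣⁅x⁆∪p∣≡1+∣p∣ x∉ ⟩
  suc ∣ ⁅ y ⁆ ∪ ⁅ z ⁆ ∣        ≡⟨ cong suc (x∉p⇒∣⁅x⁆∪p∣≡1+∣p∣ (x≢y⇒x∉⁅y⁆ y≢z)) ⟩
  suc (suc ∣ ⁅ z ⁆ ∣)          ≡⟨ cong (2 +_) (∣⁅x⁆∣≡1 z) ⟩
  3                            ∎
  where
  open ≡-Reasoning
  x∉ : x ∉ ⁅ y ⁆ ∪ ⁅ z ⁆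
  x∉ x∈ with x∈p∪q⁻ ⁅ y ⁆ ⁅ z ⁆ x∈
  ... | inj₁ x∈⁅y⁆ = x≢y (x∈⁅y⁆⇒x≡y y x∈⁅y⁆)
  ... | inj₂ x∈⁅z⁆ = x≢z (x∈⁅y⁆⇒x≡y z x∈⁅z⁆)

-- A common scheme for adjacency, non-adjacency and difference of degrees; with `Adj` it unfolds to
-- `IsClique`.
Pairwise : Rel (Fin n) 0ℓ → Subset n → Set
Pairwise R S = ∀ u v → u ∈ S → v ∈ S → u ≢ v → R u v

pairwise-triple : {R : Rel (Fin n) 0ℓ} → Symmetric R → {x y z : Fin n} →
                  R x y → R x z → R y z → Pairwise R (triple x y z)
pairwise-triple R-sym xy xz yz u v u∈ v∈ u≢v with ∈-triple⁻ u∈ | ∈-triple⁻ v∈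
... | inj₁ refl        | inj₁ refl        = contradiction refl u≢v
... | inj₁ refl        | inj₂ (inj₁ refl) = xy
... | inj₁ refl        | inj₂ (inj₂ refl) = xz
... | inj₂ (inj₁ refl) | inj₁ refl        = R-sym xy
... | inj₂ (inj₁ refl) | inj₂ (inj₁ refl) = contradiction refl u≢v
... | inj₂ (inj₁ refl) | inj₂ (inj₂ refl) = yz
... | inj₂ (inj₂ refl) | inj₁ refl        = R-sym xz
... | inj₂ (inj₂ refl) | inj₂ (inj₁ refl) = R-sym yz
... | inj₂ (inj₂ refl) | inj₂ (inj₂ refl) = contradiction refl u≢v

-- Pigeonhole on four indices, lists and minimisers.

two-or-three : {P : Pred (Fin 4) 0ℓ} → Decidable P →
  (∃ λ i → ∃ λ j → i ≢ j × P i × P j) ⊎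
  (∃ λ i → ∃ λ j → ∃ λ l → i ≢ j × i ≢ l × j ≢ l × ¬ P i × ¬ P j × ¬ P l)
two-or-three P? with P? 0F | P? 1F | P? 2F | P? 3F
... | yes p₀ | yes p₁ | _      | _      = inj₁ (0F , 1F , (λ ()) , p₀ , p₁)
... | yes p₀ | no _   | yes p₂ | _      = inj₁ (0F , 2F , (λ ()) , p₀ , p₂)
... | yes p₀ | no _   | no _   | yes p₃ = inj₁ (0F , 3F , (λ ()) , p₀ , p₃)
... | no _   | yes p₁ | yes p₂ | _      = inj₁ (1F , 2F , (λ ()) , p₁ , p₂)
... | no _   | yes p₁ | no _   | yes p₃ = inj₁ (1F , 3F , (λ ()) , p₁ , p₃)
... | no _   | no _   | yes p₂ | yes p₃ = inj₁ (2F , 3F , (λ ()) , p₂ , p₃)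
-- The rows above cover every pattern with two successes; from here on at most one index succeeds,
-- so three fail.
... | _      | no p₁  | no p₂  | no p₃  =
  inj₂ (1F , 2F , 3F , (λ ()) , (λ ()) , (λ ()) , p₁ , p₂ , p₃)
... | no p₀  | yes _  | no p₂  | no p₃  =
  inj₂ (0F , 2F , 3F , (λ ()) , (λ ()) , (λ ()) , p₀ , p₂ , p₃)
... | no p₀  | no p₁  | yes _  | no p₃  =
  inj₂ (0F , 1F , 3F , (λ ()) , (λ ()) , (λ ()) , p₀ , p₁ , p₃)
... | no p₀  | no p₁  | no p₂  | yes _  =
  inj₂ (0F , 1F , 2F , (λ ()) , (λ ()) , (λ ()) , p₀ , p₁ , p₂)

lookup-injective : {A : Set} {xs : List A} → Unique xs → Injective _≡_ _≡_ (lookup xs)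
lookup-injective (_ ∷ _)      {zero}  {zero}  _  = refl
lookup-injective (x∉xs ∷ _)   {zero}  {suc j} eq = contradiction eq (All.lookup x∉xs (∈-lookup j))
lookup-injective (x∉xs ∷ _)   {suc i} {zero}  eq = contradiction (sym eq) (All.lookup x∉xs (∈-lookup i))
lookup-injective (_ ∷ unique) {suc i} {suc j} eq = cong suc (lookup-injective unique eq)

minimiser : (f : Fin (suc n) → ℕ) → ∃ λ i → ∀ j → f i ≤ f j
minimiser {n} f = argmin f zero (allFin (suc n)) ,
  λ j → All.lookup (f[argmin]≤f[xs] {f = f} zero (allFin (suc n))) (∈-allFin j)

-- The pullback of adjacency along `f`; for injective `f` it is a copy of the subgraph induced on
-- the range of `f`.
induced : Graph n → (Fin m → Fin n) → Graph m
induced G f = record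
  { Adj        = λ i j → Adj (f i) (f j)
  ; adj?       = λ i j → adj? (f i) (f j)
  ; adj-sym    = adj-sym
  ; adj-irrefl = λ i≡j → adj-irrefl (cong f i≡j)
  }
  where open Graph G

-- Degrees inside a vertex set, and antitone sets.

module _ (G : Graph n) where
  open Graph G

  ∈-N⁺ : {u v : Fin n} → Adj u v → v ∈ N G u
  ∈-N⁺ {u} {v} uv = lookup⇒[]= v (N G u) (trans (lookup∘tabulate _ v) (dec-true (adj? u v) uv))

  ∈-N⁻ : {u v : Fin n} → v ∈ N G u → Adj u v
  ∈-N⁻ {u} {v} v∈ with adj? u v | trans (sym (lookup∘tabulate _ v)) ([]=⇒lookup v∈)
  ... | yes uv | _ = uv
  ... | no _   | ()

  u∉N[u] : {u : Fin n} → u ∉ N G u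
  u∉N[u] = adj-irrefl refl ∘ ∈-N⁻

  innerDegree : Subset n → Fin n → ℕ
  innerDegree S u = ∣ N G u ∩ S ∣

  -- Since `u` lies in `S` but is not its own neighbour, its neighbours in `S` form a proper subset
  -- of `S`.
  innerDegree<∣S∣ : {S : Subset n} {u : Fin n} → u ∈ S → innerDegree S u < ∣ S ∣
  innerDegree<∣S∣ {S} {u} u∈S =
    p⊂q⇒∣p∣<∣q∣ (p∩q⊆q (N G u) S , u , u∈S , u∉N[u] ∘ proj₁ ∘ x∈p∩q⁻ (N G u) S)

  ∣S∣≤1+innerDegree : {S : Subset n} {u : Fin n} → (∀ v → v ∈ S → u ≢ v → Adj u v) →
                      ∣ S ∣ ≤ suc (innerDegree S u)
  ∣S∣≤1+innerDegree {S} {u} u-dominates = begin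
    ∣ S ∣                    ≤⟨ p⊆q⇒∣p∣≤∣q∣ S⊆ ⟩
    ∣ ⁅ u ⁆ ∪ (N G u ∩ S) ∣  ≡⟨ x∉p⇒∣⁅x⁆∪p∣≡1+∣p∣ (u∉N[u] ∘ proj₁ ∘ x∈p∩q⁻ (N G u) S) ⟩
    suc (innerDegree S u)    ∎
    where
    open ≤-Reasoning
    S⊆ : S ⊆ ⁅ u ⁆ ∪ (N G u ∩ S)
    S⊆ {v} v∈S with u Fin.≟ v
    ... | yes refl = x∈p∪q⁺ (inj₁ (x∈⁅x⁆ u))
    ... | no  u≢v  = x∈p∪q⁺ (inj₂ (x∈p∩q⁺ (∈-N⁺ (u-dominates v v∈S u≢v) , v∈S)))

  -- Inner degrees on `S` are at most `∣ S ∣` minus one, and a vertex adjacent to all others in `S`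
  -- reaches this bound.
  innerDegree-maximal : {S : Subset n} {u v : Fin n} → (∀ w → w ∈ S → u ≢ w → Adj u w) →
                        v ∈ S → innerDegree S v ≤ innerDegree S u
  innerDegree-maximal u-dominates v∈S =
    s≤s⁻¹ (≤-trans (innerDegree<∣S∣ v∈S) (∣S∣≤1+innerDegree u-dominates))

  innerDegree≡0 : {S : Subset n} {u : Fin n} → (∀ v → v ∈ S → ¬ Adj u v) → innerDegree S u ≡ 0
  innerDegree≡0 {S} {u} isolated = trans (cong ∣_∣ (Empty-unique empty)) (∣⊥∣≡0 n)
    where
    empty : Empty (N G u ∩ S)
    empty (v , v∈) with x∈p∩q⁻ (N G u) S v∈
    ... | v∈N , v∈S = isolated v v∈S (∈-N⁻ v∈N)

  -- Guarantees that removing the neighbours inside `S` keeps the strict order of degrees on `S`.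
  Antitone : Subset n → Set
  Antitone S = ∀ u v → u ∈ S → v ∈ S → degree G u < degree G v →
               innerDegree S v ≤ innerDegree S u

  DistinctDegrees : Subset n → Set
  DistinctDegrees = Pairwise (λ u v → degree G u ≢ degree G v)

  clique-antitone : {S : Subset n} → IsClique G S → Antitone S
  clique-antitone clique u v u∈S v∈S _ =
    innerDegree-maximal (λ w w∈S → clique u w u∈S w∈S) v∈S

  independent-antitone : {S : Subset n} → IsIndependent G S → Antitone S
  independent-antitone indep u v u∈S v∈S _ =
    ≤-trans (≤-reflexive (innerDegree≡0 (λ w w∈S → indep v w v∈S w∈S))) z≤n

  -- The centre has the maximal inner degree. The neighbourhood of a leaf within `S` is exactly the
  -- centre, so two leaves have equal inner degrees.
  star-antitone : {S : Subset n} {b : Fin n} → b ∈ S →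
    (∀ v → v ∈ S → b ≢ v → Adj b v) →
    (∀ u v → u ∈ S → v ∈ S → u ≢ b → v ≢ b → ¬ Adj u v) →
    (∀ v → v ∈ S → degree G b ≤ degree G v) →
    Antitone S
  star-antitone {S} {b} b∈S centre leaves b-min u v u∈S v∈S du<dv with u Fin.≟ b
  ... | yes refl = innerDegree-maximal centre v∈S
  ... | no  u≢b  = begin
    ∣ N G v ∩ S ∣  ≤⟨ p⊆q⇒∣p∣≤∣q∣ N[v]∩S⊆⁅b⁆ ⟩
    ∣ ⁅ b ⁆ ∣      ≤⟨ p⊆q⇒∣p∣≤∣q∣ ⁅b⁆⊆N[u]∩S ⟩
    ∣ N G u ∩ S ∣  ∎
    where
    open ≤-Reasoning
    -- The bad case, a leaf `u` against the centre `v`, would give the centre a larger degree than a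
    -- leaf.
    v≢b : v ≢ b
    v≢b refl = <⇒≱ du<dv (b-min u u∈S)
    N[v]∩S⊆⁅b⁆ : N G v ∩ S ⊆ ⁅ b ⁆
    N[v]∩S⊆⁅b⁆ {w} w∈ with x∈p∩q⁻ (N G v) S w∈ | w Fin.≟ b
    ... | _ , _       | yes refl = x∈⁅x⁆ b
    ... | w∈N , w∈S   | no  w≢b  = contradiction (∈-N⁻ w∈N) (leaves v w v∈S w∈S v≢b w≢b)
    ⁅b⁆⊆N[u]∩S : ⁅ b ⁆ ⊆ N G u ∩ S
    ⁅b⁆⊆N[u]∩S w∈ with x∈⁅y⁆⇒x≡y b w∈
    ... | refl = x∈p∩q⁺ (∈-N⁺ (adj-sym (centre u u∈S (u≢b ∘ sym))) , b∈S)

  -- Complements as irregular dominating sets.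

  innerDegree+outerDegree : (S : Subset n) (u : Fin n) →
                            innerDegree S u + ∣ N G u ∩ ∁ S ∣ ≡ degree G u
  innerDegree+outerDegree S u = ∣p∩q∣+∣p∩∁q∣≡∣p∣ (N G u) S

  -- A vertex of `S` has fewer than `∣ S ∣` neighbours in `S`, hence at least one outside. Outer
  -- degrees increase strictly with degrees, and the degrees on `S` are distinct.
  ∁-irregularDominating : {S : Subset n} → (∀ v → ∣ S ∣ ≤ degree G v) →
    DistinctDegrees S → Antitone S → IsIrregularDominating G (∁ S)
  ∁-irregularDominating {S} ∣S∣≤δ distinct antitone = dominating , irregular
    where
    dominating : IsDominating G (∁ S)
    dominating v v∉ with 0<∣p∣⇒Nonempty 0<outer
      where
      0<outer : 0 < ∣ N G v ∩ ∁ S ∣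
      0<outer = +-cancelˡ-< (innerDegree S v) 0 _ (begin-strict
        innerDegree S v + 0                 ≡⟨ +-identityʳ _ ⟩
        innerDegree S v                     <⟨ innerDegree<∣S∣ (x∉∁p⇒x∈p v∉) ⟩
        ∣ S ∣                               ≤⟨ ∣S∣≤δ v ⟩
        degree G v                          ≡⟨ innerDegree+outerDegree S v ⟨
        innerDegree S v + ∣ N G v ∩ ∁ S ∣   ∎)
        where open ≤-Reasoning
    ... | u , u∈ with x∈p∩q⁻ (N G v) (∁ S) u∈
    ...   | u∈N , u∈∁S = u , u∈∁S , ∈-N⁻ u∈N

    outer-< : ∀ u v → u ∈ S → v ∈ S → degree G u < degree G v →
              ∣ N G u ∩ ∁ S ∣ < ∣ N G v ∩ ∁ S ∣
    -- Adding `innerDegree S v` to both sides avoids subtraction. Antitonicity raises it on the left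
    -- to `innerDegree S u`, which completes the degree of `u`.
    outer-< u v u∈S v∈S du<dv = +-cancelˡ-< (innerDegree S v) _ _ (begin-strict
      innerDegree S v + ∣ N G u ∩ ∁ S ∣  ≤⟨ +-monoˡ-≤ _ (antitone u v u∈S v∈S du<dv) ⟩
      innerDegree S u + ∣ N G u ∩ ∁ S ∣  ≡⟨ innerDegree+outerDegree S u ⟩
      degree G u                         <⟨ du<dv ⟩
      degree G v                         ≡⟨ innerDegree+outerDegree S v ⟨
      innerDegree S v + ∣ N G v ∩ ∁ S ∣  ∎)
      where open ≤-Reasoning

    irregular : ∀ u v → u ∉ ∁ S → v ∉ ∁ S → u ≢ v → ∣ N G u ∩ ∁ S ∣ ≢ ∣ N G v ∩ ∁ S ∣
    irregular u v u∉ v∉ u≢v with x∉∁p⇒x∈p u∉ | x∉∁p⇒x∈p v∉ | <-cmp (degree G u) (degree G v)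
    ... | u∈S | v∈S | tri< du<dv _ _ = <⇒≢ (outer-< u v u∈S v∈S du<dv)
    ... | u∈S | v∈S | tri≈ _ du≡dv _ = contradiction du≡dv (distinct u v u∈S v∈S u≢v)
    ... | u∈S | v∈S | tri> _ _ dv<du = ≢-sym (<⇒≢ (outer-< v u v∈S u∈S dv<du))

  -- The common goal of both claims: what is asked of the set removed, apart from the lower bound on
  -- the degrees.
  record AntitoneSet (k : ℕ) : Set where
    constructor antitoneSet
    field
      {carrier} : Subset n
      size      : ∣ carrier ∣ ≡ k
      distinct  : DistinctDegrees carrier
      antitone  : Antitone carrier

  -- The complement of the carrier is a competitor of size `n ∸ k` in the minimum defining `γir`.
  γir≤n∸k : {k : ℕ} → (∀ v → k ≤ degree G v) → AntitoneSet k → γir G ≤ n ∸ k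
  γir≤n∸k k≤δ (antitoneSet {S} refl distinct antitone) =
    proj₂ (proj₂ (γir-spec G)) (n ∸ ∣ S ∣)
      (∁ S , ∁-irregularDominating k≤δ distinct antitone , ∣∁p∣≡n∸∣p∣ S)

  -- Vertices representing distinct degrees.

  degreeRepresentatives : {r : ℕ} → r ≤ span G →
    ∃ λ (f : Fin r → Fin n) → Injective _≡_ _≡_ (degree G ∘ f)
  degreeRepresentatives {r} r≤span = proj₁ ∘ representative , injective
    where
    degrees : List ℕ
    degrees = map (degree G) (allFin n)
    values : List ℕ
    values = deduplicate _≟_ degrees
    value : Fin r → ℕ
    -- By definition `span G` is the length of `values`, so the indices below `r` are positions in
    -- this list.
    value i = lookup values (inject≤ i r≤span)
    representative : (i : Fin r) → ∃ λ v → degree G v ≡ value i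
    representative i
      with v , _ , value≡ ← ∈-map⁻ (degree G)
             (∈-deduplicate⁻ _≟_ degrees (∈-lookup {xs = values} (inject≤ i r≤span)))
      = v , sym value≡
    injective : Injective _≡_ _≡_ (degree G ∘ proj₁ ∘ representative)
    -- Equal degrees are equal entries of a list without repetitions, so they occupy the same
    -- position.
    injective {i} {j} eq = inject≤-injective r≤span r≤span i j
      (lookup-injective (deduplicate-! _≟_ degrees)
        (trans (sym (proj₂ (representative i))) (trans eq (proj₂ (representative j)))))

  -- Ramsey's theorem on the representatives.

  module _ {r : ℕ} (f : Fin r → Fin n) where

    image-clique : {T : Subset r} → IsClique (induced G f) T → IsClique G (image f T)
    image-clique {T} clique u v u∈ v∈ u≢v with ∈-image⁻ f T u∈ | ∈-image⁻ f T v∈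
    ... | i , i∈T , refl | j , j∈T , refl = clique i j i∈T j∈T (u≢v ∘ cong f)

    image-independent : {T : Subset r} → IsIndependent (induced G f) T →
                        IsIndependent G (image f T)
    image-independent {T} indep u v u∈ v∈ with ∈-image⁻ f T u∈ | ∈-image⁻ f T v∈
    ... | i , i∈T , refl | j , j∈T , refl = indep i j i∈T j∈T

    image-distinctDegrees : Injective _≡_ _≡_ (degree G ∘ f) → (T : Subset r) →
                            DistinctDegrees (image f T)
    image-distinctDegrees inj T u v u∈ v∈ u≢v du≡dv with ∈-image⁻ f T u∈ | ∈-image⁻ f T v∈
    ... | i , _ , refl | j , _ , refl = u≢v (cong f (inj du≡dv))

  ramseyAntitoneSet : {k r : ℕ} → RamseyProperty k k r → r ≤ span G → AntitoneSet k
  ramseyAntitoneSet {k} {r} ramsey r≤span with degreeRepresentatives r≤span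
  ... | f , inj =
    [ (λ (T , clique , ∣T∣≡k) → fromImage T ∣T∣≡k (clique-antitone (image-clique f clique)))
    , (λ (T , indep , ∣T∣≡k) → fromImage T ∣T∣≡k (independent-antitone (image-independent f indep)))
    ]′ (ramsey (induced G f))
    where
    fromImage : (T : Subset r) → ∣ T ∣ ≡ k → Antitone (image f T) → AntitoneSet k
    -- Distinct degrees make `f` itself injective, so passing to the image preserves the size.
    fromImage T ∣T∣≡k = antitoneSet (trans (∣image∣ f (inj ∘ cong (degree G)) T) ∣T∣≡k)
                          (image-distinctDegrees f inj T)

  -- Three vertices among five of distinct degrees.

  triple-clique : {x y z : Fin n} → Adj x y → Adj x z → Adj y z → IsClique G (triple x y z)
  triple-clique = pairwise-triple adj-sym

  triple-independent : {x y z : Fin n} → ¬ Adj x y → ¬ Adj x z → ¬ Adj y z →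
                       IsIndependent G (triple x y z)
  triple-independent ¬xy ¬xz ¬yz u v u∈ v∈ uv =
    pairwise-triple {R = λ u v → ¬ Adj u v} (_∘ adj-sym) ¬xy ¬xz ¬yz u v u∈ v∈
      -- `IsIndependent` also covers equal vertices, unlike `Pairwise`; there the edge would be a
      -- loop.
      (λ u≡v → adj-irrefl u≡v uv) uv

  triple-star-antitone : {b x y : Fin n} → Adj b x → Adj b y → ¬ Adj x y →
    degree G b ≤ degree G x → degree G b ≤ degree G y → Antitone (triple b x y)
  triple-star-antitone {b} {x} {y} bx by ¬xy db≤dx db≤dy =
    star-antitone ∈-tripleˡ centre leaves b-min
    where
    centre : ∀ v → v ∈ triple b x y → b ≢ v → Adj b v
    centre v v∈ b≢v with ∈-triple⁻ v∈
    ... | inj₁ refl        = contradiction refl b≢v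
    ... | inj₂ (inj₁ refl) = bx
    ... | inj₂ (inj₂ refl) = by
    leaves : ∀ u v → u ∈ triple b x y → v ∈ triple b x y → u ≢ b → v ≢ b → ¬ Adj u v
    leaves u v u∈ v∈ u≢b v≢b with ∈-triple⁻ u∈ | ∈-triple⁻ v∈
    ... | inj₁ refl        | _                = contradiction refl u≢b
    ... | inj₂ _           | inj₁ refl        = contradiction refl v≢b
    ... | inj₂ (inj₁ refl) | inj₂ (inj₁ refl) = adj-irrefl refl
    ... | inj₂ (inj₁ refl) | inj₂ (inj₂ refl) = ¬xy
    ... | inj₂ (inj₂ refl) | inj₂ (inj₁ refl) = ¬xy ∘ adj-sym
    ... | inj₂ (inj₂ refl) | inj₂ (inj₂ refl) = adj-irrefl refl
    b-min : ∀ v → v ∈ triple b x y → degree G b ≤ degree G v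
    b-min v v∈ with ∈-triple⁻ v∈
    ... | inj₁ refl        = ≤-refl
    ... | inj₂ (inj₁ refl) = db≤dx
    ... | inj₂ (inj₂ refl) = db≤dy

  module _ (f : Fin 5 → Fin n) (inj : Injective _≡_ _≡_ (degree G ∘ f))
           (i₀ : Fin 5) (i₀-min : ∀ j → degree G (f i₀) ≤ degree G (f j)) where

    private
      b : Fin n
      b = f i₀
      -- The other four vertices: `punchIn i₀` enumerates the indices different from `i₀`.
      g : Fin 4 → Fin n
      g = f ∘ punchIn i₀

      b≁g : ∀ i → degree G b ≢ degree G (g i)
      b≁g i eq = punchInᵢ≢i i₀ i (sym (inj eq))
      g≁g : ∀ {i j} → i ≢ j → degree G (g i) ≢ degree G (g j)
      g≁g i≢j eq = i≢j (punchIn-injective i₀ _ _ (inj eq))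

      fromTriple : ∀ {x y z} → degree G x ≢ degree G y → degree G x ≢ degree G z →
                   degree G y ≢ degree G z → Antitone (triple x y z) → AntitoneSet 3
      fromTriple x≁y x≁z y≁z = antitoneSet
        (∣triple∣ (x≁y ∘ cong (degree G)) (x≁z ∘ cong (degree G)) (y≁z ∘ cong (degree G)))
        (pairwise-triple {R = λ u v → degree G u ≢ degree G v} ≢-sym x≁y x≁z y≁z)

      independent-with-b : ∀ {i j} → i ≢ j → ¬ Adj b (g i) → ¬ Adj b (g j) →
                           ¬ Adj (g i) (g j) → AntitoneSet 3
      independent-with-b {i} {j} i≢j ¬bi ¬bj ¬ij =
        fromTriple (b≁g i) (b≁g j) (g≁g i≢j) (independent-antitone (triple-independent ¬bi ¬bj ¬ij))

      two-neighbours : ∀ {i j} → i ≢ j → Adj b (g i) → Adj b (g j) → AntitoneSet 3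
      two-neighbours {i} {j} i≢j bi bj with adj? (g i) (g j)
      ... | yes ij = fromTriple (b≁g i) (b≁g j) (g≁g i≢j) (clique-antitone (triple-clique bi bj ij))
      -- The minimality of `i₀` enters here: the centre `b` of the star has degree at most that of
      -- each leaf.
      ... | no ¬ij = fromTriple (b≁g i) (b≁g j) (g≁g i≢j)
                       (triple-star-antitone bi bj ¬ij (i₀-min _) (i₀-min _))

      three-nonNeighbours : ∀ {i j l} → i ≢ j → i ≢ l → j ≢ l →
        ¬ Adj b (g i) → ¬ Adj b (g j) → ¬ Adj b (g l) → AntitoneSet 3
      three-nonNeighbours {i} {j} {l} i≢j i≢l j≢l ¬bi ¬bj ¬bl
        with adj? (g i) (g j) | adj? (g i) (g l) | adj? (g j) (g l)
      ... | no ¬ij | _      | _      = independent-with-b i≢j ¬bi ¬bj ¬ij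
      ... | yes _  | no ¬il | _      = independent-with-b i≢l ¬bi ¬bl ¬il
      ... | yes _  | yes _  | no ¬jl = independent-with-b j≢l ¬bj ¬bl ¬jl
      ... | yes ij | yes il | yes jl =
        fromTriple (g≁g i≢j) (g≁g i≢l) (g≁g j≢l) (clique-antitone (triple-clique ij il jl))

    antitoneTripleAmongFive : AntitoneSet 3
    antitoneTripleAmongFive =
      [ (λ (_ , _ , i≢j , bi , bj) → two-neighbours i≢j bi bj)
      , (λ (_ , _ , _ , i≢j , i≢l , j≢l , ¬bi , ¬bj , ¬bl) →
           three-nonNeighbours i≢j i≢l j≢l ¬bi ¬bj ¬bl)
      ]′ (two-or-three (λ i → adj? b (g i)))

  antitoneTriple : 5 ≤ span G → AntitoneSet 3
  antitoneTriple 5≤span =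
    let f , inj     = degreeRepresentatives 5≤span
        i₀ , i₀-min = minimiser (degree G ∘ f)
    in antitoneTripleAmongFive f inj i₀ i₀-min

-- The minimum degree and the two bounds.

minDegree≤degree : .{{_ : NonZero n}} (G : Graph n) (v : Fin n) → minDegree G ≤ degree G v
minDegree≤degree G v = proj₂ (proj₂ (minDegree-spec G)) (degree G v) (v , refl)

theorem4p5 : (n : ℕ) .{{_ : NonZero n}} (G : Graph n) →
    ((k : ℕ) → k ≥ 1 → (r : ℕ) → IsRamseyNumber k k r →
    span G ≥ r → minDegree G ≥ k → γir G ≤ n ∸ k)
    ×
    (span G ≥ 5 → minDegree G ≥ 3 → γir G ≤ n ∸ 3)
theorem4p5 n G =
    (λ k _ r (ramsey , _) r≤span k≤δ →
       γir≤n∸k G (λ v → ≤-trans k≤δ (minDegree≤degree G v)) (ramseyAntitoneSet G ramsey r≤span))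
  , (λ 5≤span 3≤δ →
       γir≤n∸k G (λ v → ≤-trans 3≤δ (minDegree≤degree G v)) (antitoneTriple G 5≤span))
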